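{- Let $(\mathcal{M},\star)$ be a unique factorisation normed magma whose set of irreducible elements $\mathcal{M}^0$ is non-empty and finite. Then $(\mathcal{M},\star)$ is a free magma generated by its irreducible elements, i.e. by $\mathcal{M}^0$.
   Context: Here $\mathbb{N}=\{1,2,3,\dots\}$. A magma $(\mathcal{M},\star)$ is a non-empty countable set $\mathcal{M}$ (the base set) together with a map $\star:\mathcal{M}\times\mathcal{M}\to\mathcal{M}$ (no further conditions). A magma morphism $\theta:(\mathcal{M},\star)\to(\mathcal{N},\bullet)$ is a map with $\theta(m\star m')=\theta(m)\bullet\theta(m')$ for all $m,m'\in\mathcal{M}$. The range of the map $\star$ is denoted $\mathcal{M}^+$ (reducible elements); the elements of $\mathcal{M}^0=\mathcal{M}\setminus\mathcal{M}^+$ are the irreducible elements. The magma is a unique factorisation magma if the product map $\star:\mathcal{M}\times\mathcal{M}\to\mathcal{M}$ is injective. A norm on $(\mathcal{M},\star)$ is a map $\|\cdot\|:\mathcal{M}\to\mathbb{N}$ that is super-additive: $\|m_1\star m_2\|\ge\|m_1\|+\|m_2\|$ for all $m_1,m_2\in\mathcal{M}$. A normed magma is a magma that has a norm. A magma $(\mathcal{M},\star)$ is free if there exist a set $\mathcal{Y}$ and a map $i:\mathcal{Y}\to\mathcal{M}$ such that for every magma $(\mathcal{N},\bullet)$ and every map $f:\mathcal{Y}\to\mathcal{N}$ there is a unique magma morphism $\theta:\mathcal{M}\to\mathcal{N}$ with $f=\theta\circ i$. The image $i(\mathcal{Y})\subseteq\mathcal{M}$ is called the set of generators of $\mathcal{M}$,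 and $\mathcal{M}$ is said to be generated by $i(\mathcal{Y})$. -}

module Defs where

open import Algebra.Bundles using (Magma)
open import Algebra.Morphism.Structures using (module MagmaMorphisms)
open import Data.Fin.Base using (Fin)
open import Data.Nat.Base using (ℕ; _+_; _≤_)
open import Data.Product using (∃; ∃₂; ∃!; _×_; proj₁; uncurry)
open import Data.Product.Relation.Binary.Pointwise.NonDependent using (Pointwise)
open import Function.Bundles using (Func; Injection; Inverse)
open import Function.Definitions using (Injective)
open import Level using (Level; _⊔_; suc; Setω)
open import Relation.Binary.Bundles using (Setoid)
import Relation.Binary.Construct.On as On
open import Relation.Binary.PropositionalEquality using (_≡_) renaming (setoid to ≡-setoid)
open import Relation.Nullary using (¬_)
open import Relation.Unary using (Pred; _≐_; ∁)

-- Sets are setoids and maps between them respect the equivalences.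
-- A set is countable when it injects into ℕ.
record CountableMagma (c ℓ : Level) : Set (suc (c ⊔ ℓ)) where
  field
    magma     : Magma c ℓ
    nonEmpty  : Magma.Carrier magma
    countable : Injection (Magma.setoid magma) (≡-setoid ℕ)

  open Magma magma public

module _ {c ℓ} (M : CountableMagma c ℓ) where
  open CountableMagma M

  Reducible : Pred Carrier (c ⊔ ℓ)
  Reducible m = ∃₂ λ m₁ m₂ → m₁ ∙ m₂ ≈ m

  Irreducible : Pred Carrier (c ⊔ ℓ)
  Irreducible = ∁ Reducible

  -- Elements are compared in M, ignoring the proofs of irreducibility.
  irreducibles : Setoid (c ⊔ ℓ) ℓ
  irreducibles = On.setoid setoid (proj₁ {B = Irreducible})

  UniqueFactorisation : Set (c ⊔ ℓ)
  UniqueFactorisation = Injective (Pointwise _≈_ _≈_) _≈_ (uncurry _∙_)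

  record Norm : Set (c ⊔ ℓ) where
    field
      ‖_‖           : Carrier → ℕ
      ‖‖-cong       : ∀ {m₁ m₂} → m₁ ≈ m₂ → ‖ m₁ ‖ ≡ ‖ m₂ ‖
      positive      : ∀ m → 1 ≤ ‖ m ‖
      superadditive : ∀ m₁ m₂ → ‖ m₁ ‖ + ‖ m₂ ‖ ≤ ‖ m₁ ∙ m₂ ‖

Finite : ∀ {a ℓ} → Setoid a ℓ → Set (a ⊔ ℓ)
Finite S = ∃ λ n → Inverse (≡-setoid (Fin n)) S

module _ {c ℓ c′ ℓ′} (M : CountableMagma c ℓ) (N : CountableMagma c′ ℓ′) where
  private
    module M = CountableMagma M
    module N = CountableMagma N

  IsMorphism : (M.Carrier → N.Carrier) → Set (c ⊔ ℓ ⊔ ℓ′)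
  IsMorphism = MagmaMorphisms.IsMagmaHomomorphism M.rawMagma N.rawMagma

  SameMap : (θ θ′ : M.Carrier → N.Carrier) → Set (c ⊔ ℓ′)
  SameMap θ θ′ = ∀ m → θ m N.≈ θ′ m

-- Lives in Setω because the target N ranges over magmas of every level.
record Free {c ℓ} (M : CountableMagma c ℓ) : Setω where
  private module M = CountableMagma M
  field
    {y ℓy}    : Level
    Y         : Setoid y ℓy
    i         : Func Y M.setoid
    universal : ∀ {c′ ℓ′} (N : CountableMagma c′ ℓ′) (let module N = CountableMagma N)
                (f : Func Y N.setoid) →
                ∃! (SameMap M N) λ θ →
                  IsMorphism M N θ × (∀ x → Func.to f x N.≈ θ (Func.to i x))

  Generators : Pred M.Carrier (y ⊔ ℓ)
  Generators m = ∃ λ x → Func.to i x M.≈ m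

record FreeGeneratedBy {c ℓ p} (M : CountableMagma c ℓ)
                       (P : Pred (CountableMagma.Carrier M) p) : Setω where
  field
    free         : Free M
    generators≐P : Free.Generators free ≐ P

{-# OPTIONS --safe #-}
module Submission where

open import Algebra.Bundles using (Magma)
open import Algebra.Morphism.Structures using (module MagmaMorphisms)
open import Defs
open import Data.Fin.Base using (Fin)
open import Data.List.Base using (List; []; map; _++_; allFin; cartesianProductWith)
open import Data.List.Membership.Propositional using (lose)
open import Data.List.Membership.Propositional.Properties using (∈-allFin)
open import Data.List.Relation.Unary.Any using (Any; any?; satisfied)
open import Data.List.Relation.Unary.Any.Properties
  using (map⁺; ++⁺ˡ; ++⁺ʳ; cartesianProductWith⁺)
open import Data.Nat.Base using (ℕ; zero; suc; _≤_; _<_; s≤s⁻¹)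
open import Data.Nat.Properties
  using (_≟_; ≤-refl; ≤-reflexive; ≤-trans; <-≤-trans; m<m+n; m<n+m; n≮0)
open import Data.Product using (∃; _,_; proj₁; proj₂)
open import Data.Product.Relation.Binary.Pointwise.NonDependent using (Pointwise)
open import Function.Base using (_∘_)
open import Function.Bundles using (Func; Inverse)
open import Level using (Level)
open import Relation.Binary.Definitions using (Decidable)
open import Relation.Binary.PropositionalEquality as ≡ using (_≡_; cong; cong₂)
open import Relation.Nullary using (contradiction)
open import Relation.Nullary.Decidable using (via-injection; decidable-stable)
open import Relation.Unary using (Satisfiable)

-- Every element is a product of irreducibles, by induction on the norm, and by
-- unique factorisation in only one way, so a morphism is determined by its
-- values on irreducibles, which can be prescribed.  Constructively, an element
-- that is not irreducible is only not not reducible.  Finiteness of the set of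
-- irreducibles repairs this: an element of norm at most n is a product of
-- irreducibles of depth less than n, there are finitely many of those, and
-- equality is decidable since the magma embeds in ℕ, so being one of them is a
-- ¬¬-stable property.

data Term (A : Set) : Set where
  leaf : A → Term A
  node : Term A → Term A → Term A

-- Depth counts a leaf as 0, and stage `n` holds the terms of depth strictly below `n`; hence stage
-- `zero` is empty.
terms : ∀ k → ℕ → List (Term (Fin k))
terms k zero    = []
terms k (suc n) =
  map leaf (allFin k) ++ cartesianProductWith node (terms k n) (terms k n)

module _ {A : Set} {c ℓ} (N : Magma c ℓ) where
  open Magma N

  ⟦_⟧ : Term A → (A → Carrier) → Carrier
  ⟦ leaf a   ⟧ g = g a
  ⟦ node s t ⟧ g = ⟦ s ⟧ g ∙ ⟦ t ⟧ g

module _ {c ℓ c′ ℓ′} (M : CountableMagma c ℓ) (N : CountableMagma c′ ℓ′) where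
  private
    module M = CountableMagma M
    module N = CountableMagma N

  -- This is what forces the values of a morphism on all products of generators, and so gives
  -- uniqueness of the extension.
  ⟦⟧-morphism : ∀ {A : Set} {φ} → IsMorphism M N φ →
                {g : A → M.Carrier} {h : A → N.Carrier} →
                (∀ a → h a N.≈ φ (g a)) →
                ∀ t → ⟦_⟧ N.magma t h N.≈ φ (⟦_⟧ M.magma t g)
  ⟦⟧-morphism φ-mor h≈φg (leaf a)   = h≈φg a
  ⟦⟧-morphism φ-mor h≈φg (node s t) =
    N.trans (N.∙-cong (⟦⟧-morphism φ-mor h≈φg s) (⟦⟧-morphism φ-mor h≈φg t))
            (N.sym (homo _ _))
    where open MagmaMorphisms.IsMagmaHomomorphism φ-mor using (homo)

module _ {c ℓ} (M : CountableMagma c ℓ) where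
  open CountableMagma M

  ≈-dec : Decidable _≈_
  ≈-dec = via-injection countable _≟_

  Irreducible-resp-≈ : ∀ {x y} → x ≈ y → Irreducible M x → Irreducible M y
  Irreducible-resp-≈ x≈y irr (a , b , ab≈y) = irr (a , b , trans ab≈y (sym x≈y))

module Factorisation {c ℓ} (M : CountableMagma c ℓ)
                     (fin : Finite (irreducibles M)) where
  open CountableMagma M
  open Inverse (proj₂ fin) using (to; from; strictlyInverseˡ; strictlyInverseʳ; from-cong)

  k : ℕ
  k = proj₁ fin

  atom : Fin k → Carrier
  atom = proj₁ ∘ to

  atom-injective : ∀ {a b} → atom a ≈ atom b → a ≡ b
  atom-injective {a} {b} eq =
    ≡.trans (≡.sym (strictlyInverseʳ a))
      (≡.trans (from-cong eq) (strictlyInverseʳ b))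

  eval : Term (Fin k) → Carrier
  eval t = ⟦_⟧ magma t atom

  -- A leaf evaluates to an irreducible and a node to a product, so the two terms have the same
  -- head. Unique factorisation then separates the two subterms.
  eval-injective : UniqueFactorisation M → ∀ s t → eval s ≈ eval t → s ≡ t
  eval-injective uf (leaf a)   (leaf b)   eq = cong leaf (atom-injective eq)
  eval-injective uf (leaf a)   (node t u) eq =
    contradiction (eval t , eval u , sym eq) (proj₂ (to a))
  eval-injective uf (node s r) (leaf b)   eq =
    contradiction (eval s , eval r , eq) (proj₂ (to b))
  eval-injective uf (node s r) (node t u) eq =
    cong₂ node (eval-injective uf s t (proj₁ eqs)) (eval-injective uf r u (proj₂ eqs))
    where
    eqs : Pointwise _≈_ _≈_ (eval s , eval r) (eval t , eval u)
    eqs = uf eq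

  module _ (norm : Norm M) where
    open Norm norm

    -- Strictness comes from the other factor, whose norm is at least 1.
    factors-smallerˡ : ∀ {a b m} → a ∙ b ≈ m → ‖ a ‖ < ‖ m ‖
    factors-smallerˡ {a} {b} ab≈m =
      <-≤-trans (m<m+n ‖ a ‖ (positive b))
        (≤-trans (superadditive a b) (≤-reflexive (‖‖-cong ab≈m)))

    factors-smallerʳ : ∀ {a b m} → a ∙ b ≈ m → ‖ b ‖ < ‖ m ‖
    factors-smallerʳ {a} {b} ab≈m =
      <-≤-trans (m<n+m ‖ b ‖ (positive a))
        (≤-trans (superadditive a b) (≤-reflexive (‖‖-cong ab≈m)))

    eval-covers : ∀ n m → ‖ m ‖ ≤ n → Any (λ t → eval t ≈ m) (terms k n)
    eval-covers zero    m ‖m‖≤0   = contradiction (<-≤-trans (positive m) ‖m‖≤0) n≮0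
    eval-covers (suc n) m ‖m‖≤1+n =
      decidable-stable (any? (λ t → ≈-dec M (eval t) m) (terms k (suc n))) λ m∉ →
        let irr : Irreducible M m
            -- Factors of `m` have norm at most `n`, so by induction both are values of terms in
            -- `terms k n`. Joining these by `node` gives a listed term for `m`, against `m∉`.
            irr = λ (a , b , ab≈m) → m∉ (++⁺ʳ (map leaf (allFin k))
              (cartesianProductWith⁺ node
                (λ s≈a t≈b → trans (∙-cong s≈a t≈b) ab≈m)
                (eval-covers n a (s≤s⁻¹ (<-≤-trans (factors-smallerˡ ab≈m) ‖m‖≤1+n)))
                (eval-covers n b (s≤s⁻¹ (<-≤-trans (factors-smallerʳ ab≈m) ‖m‖≤1+n)))))
        -- Being irreducible, `m` is itself an atom, and every leaf is listed.
        in m∉ (++⁺ˡ (map⁺ (lose (∈-allFin (from (m , irr))) (strictlyInverseˡ (m , irr)))))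

    eval-surjective : ∀ m → ∃ λ t → eval t ≈ m
    eval-surjective m = satisfied (eval-covers ‖ m ‖ m ≤-refl)

module _ {c ℓ} (M : CountableMagma c ℓ) (uf : UniqueFactorisation M)
         (norm : Norm M) (fin : Finite (irreducibles M)) where
  private module M = CountableMagma M
  open Factorisation M fin
  open Inverse (proj₂ fin) using (to; from; strictlyInverseˡ)

  factor : M.Carrier → Term (Fin k)
  factor m = proj₁ (eval-surjective norm m)

  eval-factor : ∀ m → eval (factor m) M.≈ m
  eval-factor m = proj₂ (eval-surjective norm m)

  factor-unique : ∀ {m} t → eval t M.≈ m → factor m ≡ t
  factor-unique {m} t eq = eval-injective uf (factor m) t (M.trans (eval-factor m) (M.sym eq))

  module _ {c′ ℓ′} (N : CountableMagma c′ ℓ′)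
           (f : Func (irreducibles M) (CountableMagma.setoid N)) where
    private module N = CountableMagma N

    interpret : Term (Fin k) → N.Carrier
    interpret t = ⟦_⟧ N.magma t (Func.to f ∘ to)

    extend : M.Carrier → N.Carrier
    extend m = interpret (factor m)

    -- This frees `extend` from the chosen factorisation: each property below follows by naming a
    -- convenient term that evaluates to the element.
    extend-factor : ∀ {m} t → eval t M.≈ m → extend m N.≈ interpret t
    extend-factor t eq = N.reflexive (cong interpret (factor-unique t eq))

    extend-isMorphism : IsMorphism M N extend
    extend-isMorphism = record
      { isRelHomomorphism = record
        { cong = λ {x} {y} x≈y → extend-factor (factor y) (M.trans (eval-factor y) (M.sym x≈y)) }
      ; homo = λ x y → extend-factor (node (factor x) (factor y))
                         (M.∙-cong (eval-factor x) (eval-factor y))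
      }

    extend-extends : ∀ x → Func.to f x N.≈ extend (proj₁ x)
    -- `to (from x)` agrees with `x` only as an element of `M`, not in its irreducibility proof; `f`
    -- respects this equality.
    extend-extends x = N.trans (Func.cong f (M.sym (strictlyInverseˡ x)))
      (N.sym (extend-factor (leaf (from x)) (strictlyInverseˡ x)))

    -- The value of `φ` is forced at `eval (factor m)`, and `φ` respects the equality of that
    -- element with `m`.
    extend-unique : ∀ {φ} → IsMorphism M N φ → (∀ x → Func.to f x N.≈ φ (proj₁ x)) →
                    SameMap M N extend φ
    extend-unique φ-mor f≈φ m =
      N.trans (⟦⟧-morphism M N φ-mor (f≈φ ∘ to) (factor m)) (⟦⟧-cong (eval-factor m))
      where open MagmaMorphisms.IsMagmaHomomorphism φ-mor using (⟦⟧-cong)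

  free-on-irreducibles : Free M
  free-on-irreducibles = record
    { Y         = irreducibles M
    ; i         = record { to = proj₁ ; cong = λ eq → eq }
    ; universal = λ N f → extend N f
        , (extend-isMorphism N f , extend-extends N f)
        , λ (φ-mor , f≈φ) → extend-unique N f φ-mor f≈φ
    }

theorem1 : ∀ {c ℓ : Level} (M : CountableMagma c ℓ) →
    UniqueFactorisation M →
    Norm M →
    Satisfiable (Irreducible M) →
    Finite (irreducibles M) →
    FreeGeneratedBy M (Irreducible M)
theorem1 M uf norm _ fin = record
  { free         = free-on-irreducibles M uf norm fin
  ; generators≐P = (λ ((x , irr) , x≈m) → Irreducible-resp-≈ M x≈m irr)
                 , (λ {m} irr → (m , irr) , CountableMagma.refl M)
  }
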